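{- Let $\mathcal G=(V,\mathcal E)$ be a temporal graph, $n=|V|$, and let $(\star)$ be one of the optimality criteria shortest, shortest-foremost, prefix-foremost. Let $(s,z)$ be drawn uniformly at random from $\{(s,z)\in V\times V:s\ne z\}$, and for $v\in V$ let $\widetilde b^{(\star)}(v\mid s,z)=\sigma^{(\star)}_{sz}(v)/\sigma^{(\star)}_{sz}$. Then $\widetilde b^{(\star)}(v\mid s,z)$ is an unbiased estimator of the $(\star)$-temporal betweenness centrality: $\mathbf E[\widetilde b^{(\star)}(v\mid s,z)]=\mathtt b^{(\star)}_v$ for every $v\in V$.
   Context: A (directed) temporal graph is $\mathcal G=(V,\mathcal E)$ with $V$ finite, $n=|V|\ge2$, and $\mathcal E$ a finite set of temporal edges $(u,v,t)$, $u,v\in V$, $t\in T=\{1,\dots,|T|\}$. A temporal path from $s$ to $z\ne s$ is a sequence $((u_1,t_1),\dots,(u_k,t_k))$ with $u_1=s$, $u_k=z$, $t_1=0$, $t_i<t_{i+1}$ and $(u_i,u_{i+1},t_{i+1})\in\mathcal E$. Its length is $k-1$, its arrival time $t_k$; it is foremost if no temporal path from $s$ to $z$ arrives earlier (the trivial path from $s$ to itself arrives at time $0$). $(\star)$-optimal means: shortest (minimum length), shortest-foremost (minimum length among foremost paths), or prefix-foremost (foremost with every prefix foremost). $\sigma^{(\star)}_{sz}$ is the number of $(\star)$-optimal temporal paths from $s$ to $z$ and $\sigma^{(\star)}_{sz}(v)$ the number of those passing through $v$ for $v\notin\{s,z\}$, with $\sigma^{(\star)}_{sz}(v)=0$ if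 $v\in\{s,z\}$; the ratio $\sigma^{(\star)}_{sz}(v)/\sigma^{(\star)}_{sz}$ is $0$ if $\sigma^{(\star)}_{sz}=0$. The $(\star)$-temporal betweenness is $\mathtt b^{(\star)}_v=\frac1{n(n-1)}\sum_{s\ne v\ne z,\ s\ne z}\sigma^{(\star)}_{sz}(v)/\sigma^{(\star)}_{sz}$. -}

module Defs where

open import Data.Bool.Base using (Bool; T; if_then_else_)
open import Data.Bool.Properties using (T?)
open import Data.Empty using (⊥)
open import Data.Fin.Base as Fin using (Fin; zero; suc; toℕ)
import Data.Fin.Properties as Fin
import Data.Integer.Base as ℤ
open import Data.Integer.Base using (+_)
import Data.Integer.Properties as ℤ
open import Data.List.Base as List using (List; []; _∷_; map; foldr; filter; allFin; cartesianProduct; cartesianProductWith)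
open import Data.List.Membership.Propositional using (_∈_)
open import Data.List.Membership.Propositional.Properties using (∈-allFin; ∈-cartesianProduct⁺; ∈-cartesianProductWith⁺; ∈-cartesianProductWith⁻; ∈-filter⁺; ∈-filter⁻)
import Data.List.Membership.DecPropositional as DecMembership
open import Data.List.NonEmpty.Base as List⁺ using (List⁺; _∷_; head; tail; last; toList)
open import Data.List.Relation.Binary.Prefix.Heterogeneous using (Prefix)
open import Data.List.Relation.Binary.Prefix.Heterogeneous.Properties using (prefix?; length-mono)
open import Data.List.Relation.Unary.All as All using (All; []; _∷_)
open import Data.List.Relation.Unary.AllPairs using ([]; _∷_)
open import Data.List.Relation.Unary.Any using (here; there)
open import Data.List.Relation.Unary.Linked using (Linked; [-]; _∷_; linked?)
open import Data.List.Relation.Unary.Unique.Propositional using (Unique)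
open import Data.List.Relation.Unary.Unique.Propositional.Properties using (allFin⁺; cartesianProduct⁺; cartesianProductWith⁺; filter⁺)
open import Data.Nat.Base as ℕ using (ℕ; zero; suc; z≤n; s≤s; NonZero)
import Data.Nat.Properties as ℕ
open import Data.Product.Base using (Σ; _×_; _,_; proj₁; proj₂)
open import Data.Product.Properties using (≡-dec)
open import Data.Rational.Base as ℚ using (ℚ; 0ℚ; 1ℚ; _/_; _+_; _*_)
import Data.Rational.Properties as ℚ
import Data.Rational.Unnormalised.Base as ℚᵘ
import Data.Rational.Unnormalised.Properties as ℚᵘ
open import Function.Base using (_∘_)
open import Relation.Binary.PropositionalEquality using (_≡_; _≢_; refl; sym; trans; cong; subst)
open import Relation.Nullary using (¬_; Dec; yes; no)
open import Relation.Nullary.Decidable using (does; map′; ¬?; _×-dec_; _⊎-dec_; _→-dec_)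
open import Relation.Unary using (Decidable)

∑ : {A : Set} → List A → (A → ℚ) → ℚ
∑ xs f = foldr _+_ 0ℚ (map f xs)

infix 1 ∑
syntax ∑ xs (λ x → e) = ∑[ x ← xs ] e

-- The fraction a/b, with a/0 = 0.
ratio : ℕ → ℕ → ℚ
ratio a zero      = 0ℚ
ratio a b@(suc _) = + a / b

record Distribution (A : Set) : Set where
  field
    outcomes    : List A
    unique      : Unique outcomes
    mass        : A → ℚ
    mass-nonNeg : ∀ x → 0ℚ ℚ.≤ mass x
    mass-total  : (∑[ x ← outcomes ] mass x) ≡ 1ℚ

𝔼 : {A : Set} → Distribution A → (A → ℚ) → ℚ
𝔼 D X = ∑[ x ← outcomes ] mass x * X x
  where open Distribution D

private
  ∑-const : ∀ {A : Set} (xs : List A) d .{{_ : NonZero d}} →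
            (∑[ _ ← xs ] + 1 / d) ≡ + List.length xs / d
  ∑-const []       d       = sym (ℚ.0/n≡0 d)
  ∑-const (x ∷ xs) d@(suc _) = trans (cong (_+_ (+ 1 / d)) (∑-const xs d)) (1/d+k/d d (List.length xs))
    where
    1/d+k/d : ∀ d .{{_ : NonZero d}} k → (+ 1 / d) + (+ k / d) ≡ + suc k / d
    1/d+k/d d@(suc d-1) k = ℚ.toℚᵘ-injective (begin
      ℚ.toℚᵘ ((+ 1 / d) + (+ k / d))             ≈⟨ ℚ.toℚᵘ-homo-+ (+ 1 / d) (+ k / d) ⟩
      ℚ.toℚᵘ (+ 1 / d) ℚᵘ.+ ℚ.toℚᵘ (+ k / d)     ≈⟨ ℚᵘ.+-cong (ℚ.toℚᵘ-fromℚᵘ (ℚᵘ.mkℚᵘ (+ 1) d-1)) (ℚ.toℚᵘ-fromℚᵘ (ℚᵘ.mkℚᵘ (+ k) d-1)) ⟩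
      ℚᵘ.mkℚᵘ (+ 1) d-1 ℚᵘ.+ ℚᵘ.mkℚᵘ (+ k) d-1   ≈⟨ ℚᵘ.*≡* cross ⟩
      ℚᵘ.mkℚᵘ (+ suc k) d-1                      ≈⟨ ℚ.toℚᵘ-fromℚᵘ (ℚᵘ.mkℚᵘ (+ suc k) d-1) ⟨
      ℚ.toℚᵘ (+ suc k / d)                       ∎)
      where
      open ℚᵘ.≃-Reasoning
      cross : (+ 1 ℤ.* + d ℤ.+ + k ℤ.* + d) ℤ.* + d ≡ + suc k ℤ.* (+ d ℤ.* + d)
      cross = trans (cong (ℤ._* + d) (sym (ℤ.*-distribʳ-+ (+ d) (+ 1) (+ k))))
                    (ℤ.*-assoc (+ suc k) (+ d) (+ d))

  n/n≡1 : ∀ n .{{_ : NonZero n}} → + n / n ≡ 1ℚ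
  n/n≡1 n@(suc n-1) = ℚ.fromℚᵘ-cong {ℚᵘ.mkℚᵘ (+ n) n-1} {ℚᵘ.1ℚᵘ} (ℚᵘ.*≡* (ℤ.*-comm (+ n) (+ 1)))

uniform : {A : Set} (xs : List A) → Unique xs → .{{NonZero (List.length xs)}} → Distribution A
uniform xs xs! = record
  { outcomes    = xs
  ; unique      = xs!
  ; mass        = λ _ → + 1 / List.length xs
  ; mass-nonNeg = λ _ → ℚ.nonNegative⁻¹ (+ 1 / List.length xs) {{ℚ.normalize-nonNeg 1 (List.length xs)}}
  ; mass-total  = trans (∑-const xs (List.length xs)) (n/n≡1 (List.length xs))
  }

-- The vertex set is Fin n, and |T| = τ.  The index i : Fin τ stands for the
-- time label suc (toℕ i) ∈ {1, …, τ}.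
record TemporalGraph : Set where
  field
    n    : ℕ
    2≤n  : 2 ℕ.≤ n
    τ    : ℕ
    edge : Fin n → Fin n → Fin τ → Bool

data Criterion : Set where
  shortest shortest-foremost prefix-foremost : Criterion

module _ (G : TemporalGraph) where
  open TemporalGraph G

  Vertex : Set
  Vertex = Fin n

  -- The times {0, 1, …, τ}; time 0 is only used as the starting time t₁.
  Time : Set
  Time = Fin (suc τ)

  TemporalEdge : Vertex → Vertex → Time → Set
  TemporalEdge u v zero    = ⊥
  TemporalEdge u v (suc i) = T (edge u v i)

  Sequence : Set
  Sequence = List⁺ (Vertex × Time)

  Step : Vertex × Time → Vertex × Time → Set
  Step (u , t) (v , t′) = t Fin.< t′ × TemporalEdge u v t′

  endpoint : Sequence → Vertex
  endpoint p = proj₁ (last p)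

  arrival : Sequence → Time
  arrival p = proj₂ (last p)

  len : Sequence → ℕ
  len p = List.length (tail p)

  -- Vertex repetition is allowed, and for s ≡ z the trivial path is included, so
  -- that a foremost path from s to s arrives at time 0.
  IsTemporalPath : Vertex → Vertex → Sequence → Set
  IsTemporalPath s z p =
    head p ≡ (s , zero) × endpoint p ≡ z × Linked Step (toList p)

  Foremost : Vertex → Vertex → Sequence → Set
  Foremost s z p = IsTemporalPath s z p ×
    (∀ q → IsTemporalPath s z q → ¬ (arrival q Fin.< arrival p))

  Shortest : Vertex → Vertex → Sequence → Set
  Shortest s z p = IsTemporalPath s z p ×
    (∀ q → IsTemporalPath s z q → len p ℕ.≤ len q)

  ShortestForemost : Vertex → Vertex → Sequence → Set
  ShortestForemost s z p = Foremost s z p ×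
    (∀ q → Foremost s z q → len p ℕ.≤ len q)

  _isPrefixOf_ : Sequence → Sequence → Set
  q isPrefixOf p = Prefix _≡_ (toList q) (toList p)

  PrefixForemost : Vertex → Vertex → Sequence → Set
  PrefixForemost s z p = Foremost s z p ×
    (∀ q → q isPrefixOf p → Foremost s (endpoint q) q)

  Optimal : Criterion → Vertex → Vertex → Sequence → Set
  Optimal shortest          = Shortest
  Optimal shortest-foremost = ShortestForemost
  Optimal prefix-foremost   = PrefixForemost

  PassesThrough : Vertex → Sequence → Set
  PassesThrough v p = v ∈ map proj₁ (toList p)

  appearances : List (Vertex × Time)
  appearances = cartesianProduct (allFin n) (allFin (suc τ))

  listsUpTo : ℕ → List (List (Vertex × Time))
  listsUpTo zero    = [] ∷ []
  listsUpTo (suc k) = [] ∷ cartesianProductWith _∷_ appearances (listsUpTo k)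

  -- Times strictly increase along a temporal path, so its length is at most τ.
  candidates : List Sequence
  candidates = cartesianProductWith _∷_ appearances (listsUpTo τ)

  private
    ∈-appearances : ∀ x → x ∈ appearances
    ∈-appearances (u , t) = ∈-cartesianProduct⁺ (∈-allFin u) (∈-allFin t)

    ∈-listsUpTo : ∀ {k} xs → List.length xs ℕ.≤ k → xs ∈ listsUpTo k
    ∈-listsUpTo {zero}  []       _       = here refl
    ∈-listsUpTo {suc k} []       _       = here refl
    ∈-listsUpTo {suc k} (x ∷ xs) (s≤s b) =
      there (∈-cartesianProductWith⁺ _∷_ (∈-appearances x) (∈-listsUpTo xs b))

    ∈-candidates : ∀ {p} → len p ℕ.≤ τ → p ∈ candidates
    ∈-candidates {x ∷ xs} b = ∈-cartesianProductWith⁺ _∷_ (∈-appearances x) (∈-listsUpTo xs b)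

    appearances! : Unique appearances
    appearances! = cartesianProduct⁺ (allFin⁺ n) (allFin⁺ (suc τ))

    listsUpTo! : ∀ k → Unique (listsUpTo k)
    listsUpTo! zero    = [] ∷ []
    listsUpTo! (suc k) = All.tabulate nonempty ∷
      cartesianProductWith⁺ _∷_ (λ { refl → refl , refl }) appearances! (listsUpTo! k)
      where
      nonempty : ∀ {xs} → xs ∈ cartesianProductWith _∷_ appearances (listsUpTo k) → [] ≢ xs
      nonempty xs∈ refl with ∈-cartesianProductWith⁻ _∷_ appearances (listsUpTo k) xs∈
      ... | _ , _ , _ , _ , ()

    candidates! : Unique candidates
    candidates! = cartesianProductWith⁺ _∷_ (λ { refl → refl , refl }) appearances! (listsUpTo! τ)

    linked-bound : ∀ u t xs → Linked Step ((u , t) ∷ xs) → toℕ t ℕ.+ List.length xs ℕ.≤ τ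
    linked-bound u t [] _ =
      subst (ℕ._≤ τ) (sym (ℕ.+-identityʳ (toℕ t))) (Fin.toℕ≤pred[n] t)
    linked-bound u t ((v , t′) ∷ xs) ((t<t′ , _) ∷ l) =
      subst (ℕ._≤ τ) (sym (ℕ.+-suc (toℕ t) (List.length xs)))
        (ℕ.≤-trans (ℕ.+-monoˡ-≤ (List.length xs) t<t′) (linked-bound v t′ xs l))

    path-bound : ∀ {s z p} → IsTemporalPath s z p → len p ℕ.≤ τ
    path-bound {p = (u , t) ∷ xs} (_ , _ , l) =
      ℕ.≤-trans (ℕ.m≤n+m (List.length xs) (toℕ t)) (linked-bound u t xs l)

    foremost-bound : ∀ {s z p} → Foremost s z p → len p ℕ.≤ τ
    foremost-bound = path-bound ∘ proj₁

    optimal-bound : ∀ ⋆ {s z p} → Optimal ⋆ s z p → len p ℕ.≤ τ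
    optimal-bound shortest          = path-bound ∘ proj₁
    optimal-bound shortest-foremost = foremost-bound ∘ proj₁
    optimal-bound prefix-foremost   = foremost-bound ∘ proj₁

    ∀-dec : {P Q : Sequence → Set} → (∀ {q} → P q → len q ℕ.≤ τ) →
            Decidable P → Decidable Q → Dec (∀ q → P q → Q q)
    ∀-dec bound P? Q? = map′
      (λ all q Pq → All.lookup all (∈-candidates (bound Pq)) Pq)
      (λ f → All.tabulate (λ {q} _ → f q))
      (All.all? (λ q → P? q →-dec Q? q) candidates)

    _≟_ : (x y : Vertex × Time) → Dec (x ≡ y)
    _≟_ = ≡-dec Fin._≟_ Fin._≟_

    edge? : ∀ u v t → Dec (TemporalEdge u v t)
    edge? u v zero    = no λ ()
    edge? u v (suc i) = T? (edge u v i)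

    step? : ∀ x y → Dec (Step x y)
    step? (u , t) (v , t′) = t Fin.<? t′ ×-dec edge? u v t′

  isTemporalPath? : ∀ s z → Decidable (IsTemporalPath s z)
  isTemporalPath? s z p =
    head p ≟ (s , zero) ×-dec endpoint p Fin.≟ z ×-dec linked? step? (toList p)

  foremost? : ∀ s z → Decidable (Foremost s z)
  foremost? s z p = isTemporalPath? s z p ×-dec
    ∀-dec path-bound (isTemporalPath? s z) (λ q → ¬? (arrival q Fin.<? arrival p))

  shortest? : ∀ s z → Decidable (Shortest s z)
  shortest? s z p = isTemporalPath? s z p ×-dec
    ∀-dec path-bound (isTemporalPath? s z) (λ q → len p ℕ.≤? len q)

  shortestForemost? : ∀ s z → Decidable (ShortestForemost s z)
  shortestForemost? s z p = foremost? s z p ×-dec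
    ∀-dec foremost-bound (foremost? s z) (λ q → len p ℕ.≤? len q)

  prefixForemost? : ∀ s z → Decidable (PrefixForemost s z)
  prefixForemost? s z p with foremost? s z p
  ... | no ¬f = no (¬f ∘ proj₁)
  ... | yes f = map′ (f ,_) proj₂
    (∀-dec (λ q≤p → ℕ.≤-trans (ℕ.s≤s⁻¹ (length-mono q≤p)) (foremost-bound f))
           (λ q → prefix? _≟_ (toList q) (toList p))
           (λ q → foremost? s (endpoint q) q))

  optimal? : ∀ ⋆ s z → Decidable (Optimal ⋆ s z)
  optimal? shortest          = shortest?
  optimal? shortest-foremost = shortestForemost?
  optimal? prefix-foremost   = prefixForemost?

  passesThrough? : ∀ v → Decidable (PassesThrough v)
  passesThrough? v p = v ∈? map proj₁ (toList p)
    where open DecMembership (Fin._≟_ {n}) using (_∈?_)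

  optimalPaths : Criterion → Vertex → Vertex → List Sequence
  optimalPaths ⋆ s z = filter (optimal? ⋆ s z) candidates

  optimalPaths-complete : ∀ ⋆ {s z p} → Optimal ⋆ s z p → p ∈ optimalPaths ⋆ s z
  optimalPaths-complete ⋆ {s} {z} o = ∈-filter⁺ (optimal? ⋆ s z) (∈-candidates (optimal-bound ⋆ o)) o

  optimalPaths-sound : ∀ ⋆ {s z p} → p ∈ optimalPaths ⋆ s z → Optimal ⋆ s z p
  optimalPaths-sound ⋆ {s} {z} p∈ = proj₂ (∈-filter⁻ (optimal? ⋆ s z) {xs = candidates} p∈)

  optimalPaths-unique : ∀ ⋆ s z → Unique (optimalPaths ⋆ s z)
  optimalPaths-unique ⋆ s z = filter⁺ (optimal? ⋆ s z) candidates!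

  σ : Criterion → Vertex → Vertex → ℕ
  σ ⋆ s z = List.length (optimalPaths ⋆ s z)

  σ-through : Criterion → Vertex → Vertex → Vertex → ℕ
  σ-through ⋆ s z v =
    if does ((v Fin.≟ s) ⊎-dec (v Fin.≟ z))
    then 0
    else List.length (filter (passesThrough? v) (optimalPaths ⋆ s z))

  vertexPairs : List (Vertex × Vertex)
  vertexPairs = cartesianProduct (allFin n) (allFin n)

  private
    instance
      n[n-1]≢0 : NonZero (n ℕ.* (n ℕ.∸ 1))
      n[n-1]≢0 = nz 2≤n
        where
        nz : ∀ {m} → 2 ℕ.≤ m → NonZero (m ℕ.* (m ℕ.∸ 1))
        nz (s≤s (s≤s z≤n)) = _

  avoiding? : ∀ v → Decidable (λ (sz : Vertex × Vertex) →
                proj₁ sz ≢ v × v ≢ proj₂ sz × proj₁ sz ≢ proj₂ sz)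
  avoiding? v (s , z) = ¬? (s Fin.≟ v) ×-dec ¬? (v Fin.≟ z) ×-dec ¬? (s Fin.≟ z)

  betweenness : Criterion → Vertex → ℚ
  betweenness ⋆ v = (+ 1 / (n ℕ.* (n ℕ.∸ 1))) *
    (∑[ sz ← filter (avoiding? v) vertexPairs ]
       ratio (σ-through ⋆ (proj₁ sz) (proj₂ sz) v) (σ ⋆ (proj₁ sz) (proj₂ sz)))

  distinct? : Decidable (λ (sz : Vertex × Vertex) → proj₁ sz ≢ proj₂ sz)
  distinct? (s , z) = ¬? (s Fin.≟ z)

  distinctPairs : List (Vertex × Vertex)
  distinctPairs = filter distinct? vertexPairs

  private
    distinctPairs-nonempty : NonZero (List.length distinctPairs)
    distinctPairs-nonempty with two 2≤n
      where
      two : ∀ {m} → 2 ℕ.≤ m → Σ (Fin m × Fin m) (λ sz → proj₁ sz ≢ proj₂ sz)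
      two (s≤s (s≤s z≤n)) = (zero , suc zero) , λ ()
    ... | (s , z) , s≢z =
      occupied (∈-filter⁺ distinct? (∈-cartesianProduct⁺ (∈-allFin s) (∈-allFin z)) s≢z)
      where
      occupied : ∀ {A : Set} {x : A} {xs} → x ∈ xs → NonZero (List.length xs)
      occupied (here _)  = _
      occupied (there _) = _

  uniformDistinctPair : Distribution (Vertex × Vertex)
  uniformDistinctPair = uniform distinctPairs
    (filter⁺ distinct? (cartesianProduct⁺ (allFin⁺ n) (allFin⁺ n)))
    {{distinctPairs-nonempty}}

  estimator : Criterion → Vertex → Vertex × Vertex → ℚ
  estimator ⋆ v (s , z) = ratio (σ-through ⋆ s z v) (σ ⋆ s z)

{-# OPTIONS --safe #-}

-- Summands with v ∈ {s, z} vanish, so the sum over all pairs s ≠ z agrees with the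
-- one defining the betweenness; and there are n (n − 1) such pairs, so the mass of
-- each is the normalising factor.
module Submission where

open import Defs
open import Relation.Binary.PropositionalEquality using (_≡_)
open import Data.Fin.Properties using (_≟_)
open import Data.Integer.Base using (+_)
open import Data.List.Base using ([]; _∷_; _++_; map; filter; length; allFin; cartesianProduct)
open import Data.List.Membership.Propositional using (_∈_)
open import Data.List.Membership.Propositional.Properties using (∈-allFin)
open import Data.List.Properties using (filter-all; filter-++; length-++; length-tabulate)
open import Data.List.Relation.Unary.AllPairs using (_∷_)
open import Data.List.Relation.Unary.Any using (here; there)
open import Data.List.Relation.Unary.Unique.Propositional using (Unique)
open import Data.List.Relation.Unary.Unique.Propositional.Properties using (allFin⁺)
import Data.Nat.Base as ℕ
open ℕ using (zero; suc; NonZero)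
open import Data.Nat.Properties using (m*n≢0; <⇒≤; m<n⇒0<n∸m)
open import Data.Product.Base using (_×_; _,_; proj₁; proj₂)
open import Data.Rational.Base using (ℚ; 0ℚ; _+_; _*_; _/_)
open import Data.Rational.Properties using (*-zeroʳ; *-distribˡ-+; +-identityˡ; 0/n≡0)
open import Function.Base using (_∘_)
open import Relation.Binary.Definitions using (DecidableEquality)
open import Relation.Binary.PropositionalEquality using (_≢_; refl; sym; trans; cong; cong₂; subst; module ≡-Reasoning)
open import Relation.Nullary using (¬_; yes; no; contradiction)
open import Relation.Nullary.Decidable using (¬?)
open import Relation.Unary using (Decidable)

∑-*ˡ : ∀ {A : Set} c (f : A → ℚ) xs → (∑[ x ← xs ] c * f x) ≡ c * ∑ xs f
∑-*ˡ c f []       = sym (*-zeroʳ c)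
∑-*ˡ c f (x ∷ xs) = trans (cong (_+_ (c * f x)) (∑-*ˡ c f xs)) (sym (*-distribˡ-+ c (f x) (∑ xs f)))

-- Every entry that `Q?` drops and `P?` keeps contributes `0ℚ`, while `Q x → P x` excludes the
-- opposite mismatch, so the two sums stay in step along the list.
∑-filter-support : ∀ {A : Set} {P Q : A → Set} (P? : Decidable P) (Q? : Decidable Q) (f : A → ℚ) →
                   (∀ x → Q x → P x) → (∀ x → P x → ¬ Q x → f x ≡ 0ℚ) →
                   ∀ xs → ∑ (filter P? xs) f ≡ ∑ (filter Q? xs) f
∑-filter-support P? Q? f Q⇒P f≡0 []       = refl
∑-filter-support P? Q? f Q⇒P f≡0 (x ∷ xs) with ih ← ∑-filter-support P? Q? f Q⇒P f≡0 xs | P? x | Q? x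
... | yes _ | yes _ = cong (_+_ (f x)) ih
... | yes p | no ¬q = trans (cong₂ _+_ (f≡0 x p ¬q) ih) (+-identityˡ _)
... | no ¬p | yes q = contradiction (Q⇒P x q) ¬p
... | no _  | no _  = ih

length-filter-map : ∀ {A B : Set} {P : B → Set} (P? : Decidable P) (f : A → B) xs →
                    length (filter P? (map f xs)) ≡ length (filter (P? ∘ f) xs)
length-filter-map P? f []       = refl
length-filter-map P? f (x ∷ xs) with P? (f x)
... | yes _ = cong suc (length-filter-map P? f xs)
... | no _  = length-filter-map P? f xs

-- Count by fibres over the first coordinate; each fibre contributes the same `k`.
length-filter-cartesianProduct : ∀ {A B : Set} {P : A × B → Set} (P? : Decidable P) xs ys {k} →
                                 (∀ x → length (filter (λ y → P? (x , y)) ys) ≡ k) →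
                                 length (filter P? (cartesianProduct xs ys)) ≡ length xs ℕ.* k
length-filter-cartesianProduct P? []       ys     fibre = refl
length-filter-cartesianProduct P? (x ∷ xs) ys {k} fibre = begin
  length (filter P? (map (x ,_) ys ++ rest))
    ≡⟨ cong length (filter-++ P? (map (x ,_) ys) rest) ⟩
  length (filter P? (map (x ,_) ys) ++ filter P? rest)
    ≡⟨ length-++ (filter P? (map (x ,_) ys)) ⟩
  length (filter P? (map (x ,_) ys)) ℕ.+ length (filter P? rest)
    ≡⟨ cong₂ ℕ._+_ (trans (length-filter-map P? (x ,_) ys) (fibre x))
                   (length-filter-cartesianProduct P? xs ys fibre) ⟩
  k ℕ.+ length xs ℕ.* k ∎
  where
  open ≡-Reasoning
  rest = cartesianProduct xs ys

-- Uniqueness means that `x` occurs exactly once, so the filter discards one entry. The `suc` form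
-- avoids truncated subtraction.
length-filter-≢ : ∀ {A : Set} (_≟_ : DecidableEquality A) {x xs} → Unique xs → x ∈ xs →
                  suc (length (filter (λ y → ¬? (x ≟ y)) xs)) ≡ length xs
length-filter-≢ _≟_ {x} {y ∷ ys} (y∉ys ∷ ys!) x∈ with x ≟ y | x∈
-- The single occurrence is the head, and uniqueness says that the whole tail survives the filter.
... | yes refl | _          = cong (suc ∘ length) (filter-all (λ y → ¬? (x ≟ y)) y∉ys)
... | no x≢y   | here x≡y   = contradiction x≡y x≢y
... | no _     | there x∈ys = cong suc (length-filter-≢ _≟_ ys! x∈ys)

length-allFin : ∀ n → length (allFin n) ≡ n
length-allFin n = length-tabulate {n = n} _

-- The nonzeroness proof depends on the denominator, so plain `cong` does not apply; its irrelevance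
-- makes `refl` enough.
1/-cong : ∀ {d e} .{{_ : NonZero d}} .{{_ : NonZero e}} → d ≡ e → + 1 / d ≡ + 1 / e
1/-cong refl = refl

ratio-zeroˡ : ∀ b → ratio 0 b ≡ 0ℚ
ratio-zeroˡ zero    = refl
ratio-zeroˡ (suc b) = 0/n≡0 (suc b)

module _ (G : TemporalGraph) where
  open TemporalGraph G

  length-distinctPairs : length (distinctPairs G) ≡ n ℕ.* (n ℕ.∸ 1)
  length-distinctPairs =
    trans (length-filter-cartesianProduct (distinct? G) (allFin n) (allFin n) others)
          (cong (ℕ._* (n ℕ.∸ 1)) (length-allFin n))
    where
    others : ∀ s → length (filter (λ z → ¬? (s ≟ z)) (allFin n)) ≡ n ℕ.∸ 1
    others s = cong ℕ.pred (trans (length-filter-≢ _≟_ (allFin⁺ n) (∈-allFin s)) (length-allFin n))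

  instance
    n[n-1]≢0 : NonZero (n ℕ.* (n ℕ.∸ 1))
    -- `2≤n` is by definition `1 < n`, whence `0 < n` and `0 < n ∸ 1`.
    n[n-1]≢0 = m*n≢0 n (n ℕ.∸ 1) {{ℕ.>-nonZero (<⇒≤ 2≤n)}} {{ℕ.>-nonZero (m<n⇒0<n∸m 2≤n)}}

    distinctPairs-nonEmpty : NonZero (length (distinctPairs G))
    distinctPairs-nonEmpty = subst NonZero (sym length-distinctPairs) n[n-1]≢0

  pairMass : ℚ
  pairMass = + 1 / (n ℕ.* (n ℕ.∸ 1))

  -- The mass is constant, so it factors out of the expectation; the count of pairs then turns it
  -- into `pairMass`.
  𝔼-uniformDistinctPair : ∀ f → 𝔼 (uniformDistinctPair G) f ≡ pairMass * ∑ (distinctPairs G) f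
  𝔼-uniformDistinctPair f =
    trans (∑-*ˡ (+ 1 / length (distinctPairs G)) f (distinctPairs G))
          (cong (_* ∑ (distinctPairs G) f) (1/-cong length-distinctPairs))

  estimator-support : ∀ ⋆ v → ∑ (distinctPairs G) (estimator G ⋆ v) ≡
                      ∑ (filter (avoiding? G v) (vertexPairs G)) (estimator G ⋆ v)
  estimator-support ⋆ v = ∑-filter-support (distinct? G) (avoiding? G v) (estimator G ⋆ v)
    (λ _ → proj₂ ∘ proj₂) vanishes (vertexPairs G)
    where
    vanishes : ∀ sz → proj₁ sz ≢ proj₂ sz →
               ¬ (proj₁ sz ≢ v × v ≢ proj₂ sz × proj₁ sz ≢ proj₂ sz) → estimator G ⋆ v sz ≡ 0ℚ
    -- These are the two tests made by `σ-through`, in the same orientation, so either equality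
    -- reduces the numerator to 0.
    vanishes (s , z) s≢z ¬avoiding with v ≟ s | v ≟ z
    ... | yes _  | _      = ratio-zeroˡ (σ G ⋆ s z)
    ... | no _   | yes _  = ratio-zeroˡ (σ G ⋆ s z)
    ... | no v≢s | no v≢z = contradiction (v≢s ∘ sym , v≢z , s≢z) ¬avoiding

lemma5 : (G : TemporalGraph) (⋆ : Criterion) (v : Vertex G) →
    𝔼 (uniformDistinctPair G) (estimator G ⋆ v) ≡ betweenness G ⋆ v
lemma5 G ⋆ v = trans (𝔼-uniformDistinctPair G (estimator G ⋆ v))
                     -- The summand of `betweenness` is `estimator` written with projections,
                     -- definitionally equal to it.
                     (cong (pairMass G *_) (estimator-support G ⋆ v))
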